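{- For each pair of integers $a$ and $b$ with $a\geq 2$ and $a+1\leq b\leq 2a$, there exists a tree $T$ such that $\rho^{0}(T)=L_1(T)=a$ and $L_2(T)=b$.
   Context: All graphs are finite, undirected and simple. $N(v)$ is the open neighbourhood of $v$ and $N[v]=\{v\}\cup N(v)$ the closed neighbourhood. An open packing of $G$ is a set $S\subseteq V(G)$ with $|N(v)\cap S|\le 1$ for every vertex $v$ of $G$; the open packing number $\rho^0(G)$ is the maximum cardinality of an open packing. For an integer $k\ge 1$, a set $B\subseteq V(G)$ is a $k$-limited packing if $|N[v]\cap B|\le k$ for every vertex $v$ of $G$; $L_k(G)$ is the maximum cardinality of a $k$-limited packing in $G$. -}

module Defs where

open import Data.Fin using (Fin)
open import Data.Fin.Subset using (Subset; ∣_∣; _∩_; _∪_; ⁅_⁆)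
open import Data.List using (List; _∷_; _∷ʳ_; length)
open import Data.List.Relation.Unary.Linked using (Linked)
open import Data.List.Relation.Unary.Unique.Propositional using (Unique)
open import Data.Nat using (ℕ; _≤_; NonZero)
open import Data.Product using (∃-syntax; _×_)
open import Data.Vec using (tabulate)
open import Level using (0ℓ)
open import Relation.Binary using (Rel; Decidable; Symmetric; Irreflexive)
open import Relation.Binary.Construct.Closure.ReflexiveTransitive using (Star)
open import Relation.Binary.PropositionalEquality using (_≡_)
open import Relation.Nullary using (¬_; does)

-- Adjacency is required to be decidable so that neighbourhoods are
-- elements of Subset; classically this is no restriction.
record Graph : Set₁ where
  infix 4 _~_ _~?_
  field
    order    : ℕ
    _~_      : Rel (Fin order) 0ℓ
    _~?_     : Decidable _~_
    ~-sym    : Symmetric _~_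
    ~-irrefl : Irreflexive _≡_ _~_

  Vertex : Set
  Vertex = Fin order

  N : Vertex → Subset order
  N v = tabulate (λ u → does (v ~? u))

  N[_] : Vertex → Subset order
  N[ v ] = ⁅ v ⁆ ∪ N v

module _ (G : Graph) where
  open Graph G

  Connected : Set
  Connected = NonZero order × (∀ u v → Star _~_ u v)

  -- The cycle visiting v and then the vertices of vs before returning to v.
  -- At least three distinct vertices are needed, as v , u , v is not a cycle.
  IsCycle : Vertex → List Vertex → Set
  IsCycle v vs =
    2 ≤ length vs × Unique (v ∷ vs) × Linked _~_ (v ∷ (vs ∷ʳ v))

  Acyclic : Set
  Acyclic = ∀ v vs → ¬ IsCycle v vs

  IsTree : Set
  IsTree = Connected × Acyclic

  IsOpenPacking : Subset order → Set
  IsOpenPacking S = ∀ v → ∣ N v ∩ S ∣ ≤ 1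

  IsLimitedPacking : ℕ → Subset order → Set
  IsLimitedPacking k B = ∀ v → ∣ N[ v ] ∩ B ∣ ≤ k

IsMaxCardinality : ∀ {n} → (Subset n → Set) → ℕ → Set
IsMaxCardinality P m =
  (∃[ S ] (P S × ∣ S ∣ ≡ m)) × (∀ S → P S → ∣ S ∣ ≤ m)

-- The numbers ρ⁰ and L_k are given by their graphs as relations:
-- ρ⁰[ G ]≡ m says ρ⁰(G) = m, and L[ k , G ]≡ m says L_k(G) = m.
ρ⁰[_]≡_ : Graph → ℕ → Set
ρ⁰[ G ]≡ m = IsMaxCardinality (IsOpenPacking G) m

L[_,_]≡_ : ℕ → Graph → ℕ → Set
L[ k , G ]≡ m = IsMaxCardinality (IsLimitedPacking G k) m

{-# OPTIONS --safe #-}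

-- The tree is a star with centre s₀ and rays s₁, …, s₍ₐ₋₁₎ in which every sᵢ
-- carries a pendant leaf ℓᵢ and s₀, …, s_k, where k = b ∸ (a + 1), carry a
-- second pendant leaf eᵢ.  The a (open or closed) neighbourhoods of the sᵢ
-- cover all vertices, so ρ⁰ and L₁ are at most a, and {ℓᵢ} attains both
-- bounds.  All leaves together form a 2-limited packing of size
-- a + (k + 1) = b.  Conversely N[s₀] misses only (a ∸ 1) + k vertices and
-- contains at most two members of any 2-limited packing.
module Submission where

open import Defs
open import Data.Fin
  using (Fin; zero; suc; toℕ; _↑ˡ_; _↑ʳ_; splitAt; inject≤) renaming (_<_ to _<ᶠ_)
open import Data.Fin.Induction using (<-wellFounded)
import Data.Fin.Properties as Finₚ
open import Data.Fin.Subset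
  using (Subset; _∈_; _∉_; _⊆_; _∩_; _∪_; ∁; ⁅_⁆; ⊥; ∣_∣; inside; outside)
open import Data.Fin.Subset.Properties
open import Data.List using ([]; _∷_; _∷ʳ_)
open import Data.List.Membership.Propositional using () renaming (_∈_ to _∈ˡ_)
open import Data.List.Relation.Unary.All using (All; []; _∷_; lookup; head; tail)
open import Data.List.Relation.Unary.AllPairs using (_∷_)
open import Data.List.Relation.Unary.Any using (here; there)
open import Data.List.Relation.Unary.Linked using (Linked; _∷_)
open import Data.List.Relation.Unary.Unique.Propositional using (Unique)
open import Data.Nat using (ℕ; zero; suc; _+_; _*_; _∸_; _≤_; _<_; z≤n; s≤s)
import Data.Nat.Properties as ℕₚ
open import Data.Product using (∃-syntax; _×_; _,_; proj₁)
open import Data.Sum using (_⊎_; inj₁; inj₂; [_,_]′; swap)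
open import Data.Vec using ([]; _∷_; tabulate)
open import Data.Vec.Properties using (lookup∘tabulate; []=⇒lookup; lookup⇒[]=)
open import Function using (_∘_; const; id; Injective)
open import Induction.WellFounded using (Acc; acc)
open import Relation.Binary.Construct.Closure.ReflexiveTransitive
  using (Star; ε; _◅_; _◅◅_; reverse)
open import Relation.Binary.PropositionalEquality
  using (_≡_; _≢_; refl; sym; trans; cong; subst; subst₂)
open import Relation.Nullary
  using (yes; no; does; contradiction; _×-dec_; _⊎-dec_)
open import Relation.Nullary.Decidable using (dec-true)
open import Relation.Unary using (Pred; Decidable)

-- Finite subsets

module _ {n ℓ} {P : Pred (Fin n) ℓ} (P? : Decidable P) where

  ∈-tabulate⁺ : ∀ {x} → P x → x ∈ tabulate (does ∘ P?)
  ∈-tabulate⁺ {x} px =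
    lookup⇒[]= x _ (trans (lookup∘tabulate (does ∘ P?) x) (dec-true (P? x) px))

  ∈-tabulate⁻ : ∀ {x} → x ∈ tabulate (does ∘ P?) → P x
  ∈-tabulate⁻ {x} x∈
    with P? x | trans (sym (lookup∘tabulate (does ∘ P?) x)) ([]=⇒lookup x∈)
  ... | yes px | _  = px
  ... | no _   | ()

∣p∪q∣≤∣p∣+∣q∣ : ∀ {n} (p q : Subset n) → ∣ p ∪ q ∣ ≤ ∣ p ∣ + ∣ q ∣
∣p∪q∣≤∣p∣+∣q∣ []            []            = z≤n
∣p∪q∣≤∣p∣+∣q∣ (outside ∷ p) (outside ∷ q) = ∣p∪q∣≤∣p∣+∣q∣ p q
∣p∪q∣≤∣p∣+∣q∣ (inside  ∷ p) (outside ∷ q) = s≤s (∣p∪q∣≤∣p∣+∣q∣ p q)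
∣p∪q∣≤∣p∣+∣q∣ (outside ∷ p) (inside  ∷ q) =
  subst (suc ∣ p ∪ q ∣ ≤_) (sym (ℕₚ.+-suc ∣ p ∣ ∣ q ∣)) (s≤s (∣p∪q∣≤∣p∣+∣q∣ p q))
∣p∪q∣≤∣p∣+∣q∣ (inside  ∷ p) (inside  ∷ q) =
  s≤s (ℕₚ.≤-trans (∣p∪q∣≤∣p∣+∣q∣ p q) (ℕₚ.+-monoʳ-≤ ∣ p ∣ (ℕₚ.n≤1+n ∣ q ∣)))

p⊆q∪r⇒∣p∣≤∣q∣+∣r∣ : ∀ {n} {p : Subset n} q r → p ⊆ q ∪ r → ∣ p ∣ ≤ ∣ q ∣ + ∣ r ∣
p⊆q∪r⇒∣p∣≤∣q∣+∣r∣ q r p⊆ = ℕₚ.≤-trans (p⊆q⇒∣p∣≤∣q∣ p⊆) (∣p∪q∣≤∣p∣+∣q∣ q r)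

∩-monoʳ-⊆ : ∀ {n} (p : Subset n) {q r} → q ⊆ r → p ∩ q ⊆ p ∩ r
∩-monoʳ-⊆ p {q} q⊆r x∈ with x∈p∩q⁻ p q x∈
... | x∈p , x∈q = x∈p∩q⁺ (x∈p , q⊆r x∈q)

subsingleton⇒∣p∣≤1 : ∀ {n} (p : Subset n) →
                     (∀ {x y} → x ∈ p → y ∈ p → x ≡ y) → ∣ p ∣ ≤ 1
subsingleton⇒∣p∣≤1 {n} p unique with nonempty? p
... | yes (x , x∈p) = subst (∣ p ∣ ≤_) (∣⁅x⁆∣≡1 x)
  (p⊆q⇒∣p∣≤∣q∣ λ {y} y∈p → subst (_∈ ⁅ x ⁆) (unique x∈p y∈p) (x∈⁅x⁆ x))
... | no empty = ℕₚ.≤-trans (ℕₚ.≤-reflexive (trans (cong ∣_∣ (Empty-unique empty)) (∣⊥∣≡0 n))) z≤n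

-- Induction on the number of covering sets: `f zero` accounts for at most `t` elements of `p`, and
-- whatever lies outside it is covered by the remaining sets.
cover-bound : ∀ {m n} t (f : Fin m → Subset n) (p : Subset n) →
              (∀ {x} → x ∈ p → ∃[ i ] x ∈ f i) →
              (∀ i → ∣ f i ∩ p ∣ ≤ t) → ∣ p ∣ ≤ m * t
cover-bound {zero} {n} t f p cover small = ℕₚ.≤-reflexive
  (trans (cong ∣_∣ (Empty-unique λ (x , x∈p) → Finₚ.¬Fin0 (proj₁ (cover x∈p)))) (∣⊥∣≡0 n))
cover-bound {suc m} t f p cover small =
  ℕₚ.≤-trans (p⊆q∪r⇒∣p∣≤∣q∣+∣r∣ (f zero ∩ p) rest split)
    (ℕₚ.+-mono-≤ (small zero) (cover-bound t (f ∘ suc) rest rest-cover rest-small))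
  where
  rest : Subset _
  rest = p ∩ ∁ (f zero)

  split : p ⊆ (f zero ∩ p) ∪ rest
  split {x} x∈p with x ∈? f zero
  ... | yes x∈f = x∈p∪q⁺ (inj₁ (x∈p∩q⁺ (x∈f , x∈p)))
  ... | no x∉f  = x∈p∪q⁺ (inj₂ (x∈p∩q⁺ (x∈p , x∉p⇒x∈∁p x∉f)))

  rest-cover : ∀ {x} → x ∈ rest → ∃[ i ] x ∈ f (suc i)
  rest-cover x∈ with x∈p∩q⁻ p (∁ (f zero)) x∈
  ... | x∈p , x∈∁ with cover x∈p
  ...   | zero  , x∈f = contradiction x∈f (x∈∁p⇒x∉p x∈∁)
  ...   | suc i , x∈f = i , x∈f

  rest-small : ∀ i → ∣ f (suc i) ∩ rest ∣ ≤ t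
  rest-small i = ℕₚ.≤-trans
    (p⊆q⇒∣p∣≤∣q∣ (∩-monoʳ-⊆ (f (suc i)) (p∩q⊆p p (∁ (f zero))))) (small (suc i))

image : ∀ {m n} → (Fin m → Fin n) → Subset n
image {zero}  f = ⊥
image {suc m} f = ⁅ f zero ⁆ ∪ image (f ∘ suc)

∈-image⁺ : ∀ {m n} (f : Fin m → Fin n) i → f i ∈ image f
∈-image⁺ f zero    = x∈p∪q⁺ (inj₁ (x∈⁅x⁆ (f zero)))
∈-image⁺ f (suc i) = x∈p∪q⁺ (inj₂ (∈-image⁺ (f ∘ suc) i))

∈-image⁻ : ∀ {m n} (f : Fin m → Fin n) {x} → x ∈ image f → ∃[ i ] x ≡ f i
∈-image⁻ {zero}  f x∈ = contradiction x∈ ∉⊥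
∈-image⁻ {suc m} f x∈ with x∈p∪q⁻ ⁅ f zero ⁆ (image (f ∘ suc)) x∈
... | inj₁ x∈⁅⁆ = zero , x∈⁅y⁆⇒x≡y (f zero) x∈⁅⁆
... | inj₂ x∈im with ∈-image⁻ (f ∘ suc) x∈im
...   | i , eq  = suc i , eq

∣image∣≤ : ∀ {m n} (f : Fin m → Fin n) → ∣ image f ∣ ≤ m
∣image∣≤ {zero}  {n} f = ℕₚ.≤-reflexive (∣⊥∣≡0 n)
∣image∣≤ {suc m} f = ℕₚ.≤-trans (∣p∪q∣≤∣p∣+∣q∣ ⁅ f zero ⁆ (image (f ∘ suc)))
  (ℕₚ.+-mono-≤ (ℕₚ.≤-reflexive (∣⁅x⁆∣≡1 (f zero))) (∣image∣≤ (f ∘ suc)))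

-- Injectivity makes `f zero` fresh, so adjoining it strictly enlarges the image of the tail.
∣image∣≥ : ∀ {m n} (f : Fin m → Fin n) → Injective _≡_ _≡_ f → m ≤ ∣ image f ∣
∣image∣≥ {zero}  f inj = z≤n
∣image∣≥ {suc m} f inj =
  ℕₚ.≤-<-trans (∣image∣≥ (f ∘ suc) (Finₚ.suc-injective ∘ inj))
    (p⊂q⇒∣p∣<∣q∣ (q⊆p∪q _ _ , f zero , ∈-image⁺ f zero , fresh))
  where
  fresh : f zero ∉ image (f ∘ suc)
  fresh f0∈ with ∈-image⁻ (f ∘ suc) f0∈
  ... | i , eq with () ← inj eq

∣image∣≡ : ∀ {m n} (f : Fin m → Fin n) → Injective _≡_ _≡_ f → ∣ image f ∣ ≡ m
∣image∣≡ f inj = ℕₚ.≤-antisym (∣image∣≤ f) (∣image∣≥ f inj)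

-- Packings in arbitrary graphs

module _ (G : Graph) where
  open Graph G

  ∈N⁺ : ∀ {v x} → v ~ x → x ∈ N v
  ∈N⁺ {v} = ∈-tabulate⁺ (v ~?_)

  ∈N⁻ : ∀ {v x} → x ∈ N v → v ~ x
  ∈N⁻ {v} = ∈-tabulate⁻ (v ~?_)

  ∈N[]⁺ : ∀ {v x} → x ≡ v ⊎ v ~ x → x ∈ N[ v ]
  ∈N[]⁺ {v} (inj₁ refl) = x∈p∪q⁺ (inj₁ (x∈⁅x⁆ v))
  ∈N[]⁺     (inj₂ v~x)  = x∈p∪q⁺ (inj₂ (∈N⁺ v~x))

  ∈N[]⁻ : ∀ {v x} → x ∈ N[ v ] → x ≡ v ⊎ v ~ x
  ∈N[]⁻ {v} x∈ with x∈p∪q⁻ ⁅ v ⁆ (N v) x∈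
  ... | inj₁ x∈⁅v⁆ = inj₁ (x∈⁅y⁆⇒x≡y v x∈⁅v⁆)
  ... | inj₂ x∈N   = inj₂ (∈N⁻ x∈N)

  -- Serves to obtain the 2-limited packing of all pendant vertices from two 1-limited ones.
  limitedPacking-∪ : ∀ {j k P Q} → IsLimitedPacking G j P → IsLimitedPacking G k Q →
                     IsLimitedPacking G (j + k) (P ∪ Q)
  limitedPacking-∪ {P = P} {Q} packP packQ v = ℕₚ.≤-trans
    (p⊆q∪r⇒∣p∣≤∣q∣+∣r∣ (N[ v ] ∩ P) (N[ v ] ∩ Q) (⊆-reflexive (∩-distribˡ-∪ N[ v ] P Q)))
    (ℕₚ.+-mono-≤ (packP v) (packQ v))

  limitedPacking-⊆ : ∀ {k P Q} → P ⊆ Q → IsLimitedPacking G k Q → IsLimitedPacking G k P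
  limitedPacking-⊆ P⊆Q packQ v =
    ℕₚ.≤-trans (p⊆q⇒∣p∣≤∣q∣ (∩-monoʳ-⊆ N[ v ] P⊆Q)) (packQ v)

  module _ {m} (s : Fin m → Vertex) where

    -- A total dominating family bounds ρ⁰ from above: its open neighbourhoods cover the graph, and
    -- each contains at most one member of `S`.
    openPacking-bound : (∀ x → ∃[ i ] s i ~ x) → ∀ S → IsOpenPacking G S → ∣ S ∣ ≤ m
    openPacking-bound dominate S pack = subst (∣ S ∣ ≤_) (ℕₚ.*-identityʳ m)
      (cover-bound 1 (N ∘ s) S (λ {x} _ → cover x) (pack ∘ s))
      where
      cover : ∀ x → ∃[ i ] x ∈ N (s i)
      cover x with dominate x
      ... | i , si~x = i , ∈N⁺ si~x

    limitedPacking-bound : ∀ {k} → (∀ x → ∃[ i ] (x ≡ s i ⊎ s i ~ x)) →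
                           ∀ S → IsLimitedPacking G k S → ∣ S ∣ ≤ m * k
    limitedPacking-bound dominate S pack =
      cover-bound _ (N[_] ∘ s) S (λ {x} _ → cover x) (pack ∘ s)
      where
      cover : ∀ x → ∃[ i ] x ∈ N[ s i ]
      cover x with dominate x
      ... | i , x∈ = i , ∈N[]⁺ x∈

  -- At most `k` members of `S` lie in `N[ c ]`, and all others are among the values of `g`. For
  -- 2-limited packings of the star, covering by all supports would give only twice the number of
  -- supports.
  limitedPacking-bound-rest : ∀ {m k} (c : Vertex) (g : Fin m → Vertex) →
                              (∀ x → (x ≡ c ⊎ c ~ x) ⊎ ∃[ i ] x ≡ g i) →
                              ∀ S → IsLimitedPacking G k S → ∣ S ∣ ≤ k + m
  limitedPacking-bound-rest c g cover S pack = ℕₚ.≤-trans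
    (p⊆q∪r⇒∣p∣≤∣q∣+∣r∣ (N[ c ] ∩ S) (image g) S⊆)
    (ℕₚ.+-mono-≤ (pack c) (∣image∣≤ g))
    where
    S⊆ : S ⊆ (N[ c ] ∩ S) ∪ image g
    S⊆ {x} x∈S with cover x
    ... | inj₁ near       = x∈p∪q⁺ (inj₁ (x∈p∩q⁺ (∈N[]⁺ near , x∈S)))
    ... | inj₂ (i , refl) = x∈p∪q⁺ (inj₂ (∈-image⁺ g i))

-- Graphs given by a parent function

module ParentGraph {n} (par : Fin n → Fin n) where

  infix 4 _▷_

  -- Only parents smaller than their children count, which excludes loops and
  -- cycles for arbitrary par.
  _▷_ : Fin n → Fin n → Set
  u ▷ v = u <ᶠ v × par v ≡ u

  graph : Graph
  graph = record
    { order    = n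
    ; _~_      = λ u v → u ▷ v ⊎ v ▷ u
    ; _~?_     = λ u v → (u Finₚ.<? v ×-dec par v Finₚ.≟ u)
                   ⊎-dec (v Finₚ.<? u ×-dec par u Finₚ.≟ v)
    ; ~-sym    = swap
    ; ~-irrefl = λ { refl (inj₁ (v<v , _)) → Finₚ.<-irrefl refl v<v
                   ; refl (inj₂ (v<v , _)) → Finₚ.<-irrefl refl v<v }
    }
  open Graph graph using (_~_)

  -- Passing to the parent lowers the index, so by well-foundedness it stops, and it can stop only
  -- at `r`. Any two vertices are then joined through `r`.
  connected : (r : Fin n) → (∀ v → v ≢ r → par v <ᶠ v) → Connected graph
  connected r par< =
    Finₚ.nonZeroIndex r , λ u v → toRoot u ◅◅ reverse swap (toRoot v)
    where
    climb : ∀ v → Acc _<ᶠ_ v → Star _~_ v r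
    climb v (acc rec) with v Finₚ.≟ r
    ... | yes refl = ε
    ... | no v≢r   = inj₂ (par< v v≢r , refl) ◅ climb (par v) (rec (par< v v≢r))

    toRoot : ∀ v → Star _~_ v r
    toRoot v = climb v (<-wellFounded v)

  -- A walk without backtracking that has taken a step to a child can only
  -- continue to children.
  descend : ∀ {u w v} ws → u ▷ w → All (u ≢_) ws → Unique (w ∷ ws) →
            u ≢ v → All (v ≢_) (w ∷ ws) → Linked _~_ (w ∷ (ws ∷ʳ v)) →
            w <ᶠ v × par v ∈ˡ (w ∷ ws)
  descend [] u▷w _ _ u≢v v∉ (inj₁ (w<v , eq) ∷ _) = w<v , here eq
  descend [] (_ , refl) _ _ u≢v v∉ (inj₂ (_ , eq) ∷ _) = contradiction eq u≢v
  descend (x ∷ xs) u▷w u∉ (w∉ ∷ uniq) u≢v (v≢w ∷ v∉) (inj₁ w▷x@(w<x , _) ∷ link)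
    with descend xs w▷x (tail w∉) uniq (v≢w ∘ sym) v∉ link
  ... | x<v , par∈ = Finₚ.<-trans w<x x<v , there par∈
  descend (x ∷ xs) (_ , refl) (u≢x ∷ _) _ _ _ (inj₂ (_ , eq) ∷ _) = contradiction eq u≢x

  -- While the walk climbs, its index stays below `v`, so no step to a parent can end at `v`. Either
  -- it enters `v` as a child, or it turns down earlier and `descend` applies.
  ascend : ∀ {x v} ws → Unique (x ∷ ws) → x <ᶠ v → All (v ≢_) (x ∷ ws) →
           Linked _~_ (x ∷ (ws ∷ʳ v)) → par v ∈ˡ (x ∷ ws)
  ascend [] _ x<v _ (inj₁ (_ , eq) ∷ _) = here eq
  ascend [] _ x<v _ (inj₂ (v<x , _) ∷ _) = contradiction v<x (Finₚ.<-asym x<v)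
  ascend (y ∷ ys) ((_ ∷ x∉) ∷ uniq) x<v (v≢x ∷ v∉) (inj₁ x▷y ∷ link)
    with descend ys x▷y x∉ uniq (v≢x ∘ sym) v∉ link
  ... | _ , par∈ = there par∈
  ascend (y ∷ ys) (_ ∷ uniq) x<v (_ ∷ v∉) (inj₂ (y<x , _) ∷ link) =
    there (ascend ys uniq (Finₚ.<-trans y<x x<v) v∉ link)

  -- A cycle entered through a child of v never comes back down to v.  If it is
  -- entered through the parent of v, it has to return through that parent.
  acyclic : Acyclic graph
  acyclic v (x ∷ [])     (s≤s () , _)
  acyclic v (x ∷ y ∷ ys) (_ , (v≢x ∷ v∉) ∷ (x∉ ∷ uniq) , inj₁ (v<x , eq) ∷ inj₂ (_ , eq′) ∷ _) =
    contradiction (trans (sym eq) eq′) (head v∉)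
  acyclic v (x ∷ y ∷ ys) (_ , (v≢x ∷ v∉) ∷ ((_ ∷ x∉) ∷ uniq) , inj₁ (v<x , _) ∷ inj₁ x▷y@(x<y , _) ∷ link)
    with descend ys x▷y x∉ uniq (v≢x ∘ sym) v∉ link
  ... | y<v , _ = Finₚ.<-asym v<x (Finₚ.<-trans x<y y<v)
  acyclic v (x ∷ y ∷ ys) (_ , (v≢x ∷ v∉) ∷ (x∉@(_ ∷ x∉ys) ∷ uniq) , inj₂ (_ , refl) ∷ inj₁ x▷y ∷ link)
    with descend ys x▷y x∉ys uniq (v≢x ∘ sym) v∉ link
  ... | _ , par∈ = lookup x∉ par∈ refl
  acyclic v (x ∷ y ∷ ys) (_ , (v≢x ∷ v∉) ∷ (x∉ ∷ uniq) , inj₂ (x<v , refl) ∷ inj₂ (y<x , _) ∷ link) =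
    lookup x∉ (ascend ys uniq (Finₚ.<-trans y<x x<v) v∉ link) refl

  module _ {m} (f : Fin m → Fin n) (childless : ∀ i u → par u ≢ f i)
           (par-inj : Injective _≡_ _≡_ (par ∘ f)) where

    ~childless⇒parent : ∀ {v} i → v ~ f i → par (f i) ≡ v
    ~childless⇒parent i (inj₁ (_ , eq)) = eq
    ~childless⇒parent i (inj₂ (_ , eq)) = contradiction eq (childless i _)

    -- A childless neighbour of `v` can only be a child of `v`, and injectivity of `par ∘ f` leaves
    -- at most one chosen child per parent.
    childless-openPacking : IsOpenPacking graph (image f)
    childless-openPacking v = subsingleton⇒∣p∣≤1 _ unique
      where
      unique : ∀ {x y} → x ∈ Graph.N graph v ∩ image f → y ∈ Graph.N graph v ∩ image f → x ≡ y
      unique x∈ y∈ with x∈p∩q⁻ _ _ x∈ | x∈p∩q⁻ _ _ y∈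
      ... | x∈N , x∈f | y∈N , y∈f with ∈-image⁻ f x∈f | ∈-image⁻ f y∈f
      ... | i , refl | j , refl = cong f (par-inj
        (trans (~childless⇒parent i (∈N⁻ graph x∈N)) (sym (~childless⇒parent j (∈N⁻ graph y∈N)))))

    childless-1-limitedPacking : IsLimitedPacking graph 1 (image f)
    childless-1-limitedPacking v = subsingleton⇒∣p∣≤1 _ unique
      where
      unique : ∀ {x y} → x ∈ Graph.N[_] graph v ∩ image f → y ∈ Graph.N[_] graph v ∩ image f → x ≡ y
      unique x∈ y∈ with x∈p∩q⁻ _ _ x∈ | x∈p∩q⁻ _ _ y∈
      ... | x∈N , x∈f | y∈N , y∈f with ∈-image⁻ f x∈f | ∈-image⁻ f y∈f
      ... | i , refl | j , refl with ∈N[]⁻ graph x∈N | ∈N[]⁻ graph y∈N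
      ... | inj₁ x≡v | inj₁ y≡v = trans x≡v (sym y≡v)
      -- Here `v` itself is chosen, hence childless, so it cannot be the parent of the other chosen
      -- vertex.
      ... | inj₁ x≡v | inj₂ v~y =
        contradiction (trans (~childless⇒parent j v~y) (sym x≡v)) (childless i _)
      ... | inj₂ v~x | inj₁ y≡v =
        contradiction (trans (~childless⇒parent i v~x) (sym y≡v)) (childless j _)
      ... | inj₂ v~x | inj₂ v~y =
        cong f (par-inj (trans (~childless⇒parent i v~x) (sym (~childless⇒parent j v~y))))

-- The star with pendant leaves

↑ˡ<↑ʳ : ∀ {m n} (i : Fin m) (j : Fin n) → i ↑ˡ n <ᶠ m ↑ʳ j
↑ˡ<↑ʳ {m} {n} i j = subst₂ _<_ (sym (Finₚ.toℕ-↑ˡ i n)) (sym (Finₚ.toℕ-↑ʳ m j))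
  (ℕₚ.<-≤-trans (Finₚ.toℕ<n i) (ℕₚ.m≤m+n m (toℕ j)))

module LeafyStar (p k : ℕ) (k≤p : k ≤ p) where

  -- With the supports first and the centre at index 0, the intended parents precede their children,
  -- as `_▷_` requires, and the pendant vertices form the block `a ↑ʳ_`.
  a order : ℕ
  a     = suc p
  order = a + (a + suc k)

  support leaf : Fin a → Fin order
  support i = i ↑ˡ (a + suc k)
  leaf i    = a ↑ʳ (i ↑ˡ suc k)

  extra : Fin (suc k) → Fin order
  extra j = a ↑ʳ (a ↑ʳ j)

  bearer : Fin (suc k) → Fin a
  bearer j = inject≤ j (s≤s k≤p)

  -- With `support` outermost, every value is visibly a support, which makes pendant vertices
  -- childless in `par≢↑ʳ`. The centre is its own parent, but this creates no loop because `_▷_`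
  -- asks for a strictly smaller parent.
  par : Fin order → Fin order
  par v = support ([ const zero , [ id , bearer ]′ ∘ splitAt a ]′ (splitAt a v))

  open ParentGraph par public
  open Graph graph using (_~_)

  data View : Fin order → Set where
    isSupport : ∀ i → View (support i)
    isLeaf    : ∀ i → View (leaf i)
    isExtra   : ∀ j → View (extra j)

  view : ∀ v → View v
  view v with splitAt a v | Finₚ.join-splitAt a (a + suc k) v
  ... | inj₁ i | refl = isSupport i
  ... | inj₂ w | refl with splitAt a w | Finₚ.join-splitAt a (suc k) w
  ...   | inj₁ i | refl = isLeaf i
  ...   | inj₂ j | refl = isExtra j

  par-support : ∀ i → par (support i) ≡ support zero
  par-support i rewrite Finₚ.splitAt-↑ˡ a i (a + suc k) = refl

  par-leaf : ∀ i → par (leaf i) ≡ support i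
  par-leaf i rewrite Finₚ.splitAt-↑ʳ a (a + suc k) (i ↑ˡ suc k)
                   | Finₚ.splitAt-↑ˡ a i (suc k) = refl

  par-extra : ∀ j → par (extra j) ≡ support (bearer j)
  par-extra j rewrite Finₚ.splitAt-↑ʳ a (a + suc k) (a ↑ʳ j)
                    | Finₚ.splitAt-↑ʳ a (suc k) j = refl

  support-injective : Injective _≡_ _≡_ support
  support-injective = Finₚ.↑ˡ-injective (a + suc k) _ _

  zero▷suc : ∀ i → support zero ▷ support (suc i)
  zero▷suc i = s≤s z≤n , par-support (suc i)

  support▷leaf : ∀ i → support i ▷ leaf i
  support▷leaf i = ↑ˡ<↑ʳ i _ , par-leaf i

  support▷extra : ∀ j → support (bearer j) ▷ extra j
  support▷extra j = ↑ˡ<↑ʳ (bearer j) _ , par-extra j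

  isTree : IsTree graph
  isTree = connected (support zero) par< , acyclic
    where
    ▷⇒par< : ∀ {u v} → u ▷ v → par v <ᶠ v
    ▷⇒par< (u<v , refl) = u<v

    par< : ∀ v → v ≢ support zero → par v <ᶠ v
    par< v v≢0 with view v
    ... | isSupport zero    = contradiction refl v≢0
    ... | isSupport (suc i) = ▷⇒par< (zero▷suc i)
    ... | isLeaf i          = ▷⇒par< (support▷leaf i)
    ... | isExtra j         = ▷⇒par< (support▷extra j)

  par≢↑ʳ : ∀ (i : Fin (a + suc k)) u → par u ≢ a ↑ʳ i
  par≢↑ʳ i u eq = Finₚ.<-irrefl eq (↑ˡ<↑ʳ _ i)

  leaf-par-injective : Injective _≡_ _≡_ (par ∘ leaf)
  leaf-par-injective {i} {j} eq =
    support-injective (trans (sym (par-leaf i)) (trans eq (par-leaf j)))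

  extra-par-injective : Injective _≡_ _≡_ (par ∘ extra)
  extra-par-injective {i} {j} eq = Finₚ.inject≤-injective (s≤s k≤p) (s≤s k≤p) i j
    (support-injective (trans (sym (par-extra i)) (trans eq (par-extra j))))

  leaf-injective : Injective _≡_ _≡_ leaf
  leaf-injective = leaf-par-injective ∘ cong par

  dominating : ∀ v → ∃[ i ] (v ≡ support i ⊎ support i ~ v)
  dominating v with view v
  ... | isSupport i = i , inj₁ refl
  ... | isLeaf i    = i , inj₂ (inj₁ (support▷leaf i))
  ... | isExtra j   = bearer j , inj₂ (inj₁ (support▷extra j))

  total-dominating : 1 ≤ p → ∀ v → ∃[ i ] support i ~ v
  total-dominating (s≤s _) v with view v
  -- The centre is not in its own open neighbourhood, so another support has to dominate it; `1 ≤ p`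
  -- provides one.
  ... | isSupport zero    = suc zero , inj₂ (zero▷suc zero)
  ... | isSupport (suc i) = zero , inj₁ (zero▷suc i)
  ... | isLeaf i          = i , inj₁ (support▷leaf i)
  ... | isExtra j         = bearer j , inj₁ (support▷extra j)

  ρ⁰≡ : 1 ≤ p → ρ⁰[ graph ]≡ a
  ρ⁰≡ 1≤p =
    (image leaf , childless-openPacking leaf (λ i → par≢↑ʳ _) leaf-par-injective ,
      ∣image∣≡ leaf leaf-injective) ,
    openPacking-bound graph support (total-dominating 1≤p)

  leaf-packing : IsLimitedPacking graph 1 (image leaf)
  leaf-packing = childless-1-limitedPacking leaf (λ i → par≢↑ʳ _) leaf-par-injective

  extra-packing : IsLimitedPacking graph 1 (image extra)
  extra-packing = childless-1-limitedPacking extra (λ i → par≢↑ʳ _) extra-par-injective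

  L₁≡ : L[ 1 , graph ]≡ a
  L₁≡ =
    (image leaf , leaf-packing , ∣image∣≡ leaf leaf-injective) ,
    λ S pack → subst (∣ S ∣ ≤_) (ℕₚ.*-identityʳ a)
      (limitedPacking-bound graph support dominating S pack)

  -- As the image of one injection this set has its cardinality at once; for the packing property,
  -- inclusion in the union of the two images suffices.
  allLeaves : Subset order
  allLeaves = image (a ↑ʳ_)

  allLeaves⊆ : allLeaves ⊆ image leaf ∪ image extra
  allLeaves⊆ x∈ with ∈-image⁻ (a ↑ʳ_) x∈
  ... | i , refl with splitAt a i | Finₚ.join-splitAt a (suc k) i
  ...   | inj₁ j | refl = x∈p∪q⁺ (inj₁ (∈-image⁺ leaf j))
  ...   | inj₂ j | refl = x∈p∪q⁺ (inj₂ (∈-image⁺ extra j))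

  -- The vertices outside the closed neighbourhood of the centre: index zero is skipped twice
  -- because `leaf zero` and `extra zero` hang on the centre.
  remote : Fin (p + k) → Fin order
  remote = [ leaf ∘ suc , extra ∘ suc ]′ ∘ splitAt p

  near-or-remote : ∀ v → (v ≡ support zero ⊎ support zero ~ v) ⊎ ∃[ i ] v ≡ remote i
  near-or-remote v with view v
  ... | isSupport zero    = inj₁ (inj₁ refl)
  ... | isSupport (suc i) = inj₁ (inj₂ (inj₁ (zero▷suc i)))
  ... | isLeaf zero       = inj₁ (inj₂ (inj₁ (support▷leaf zero)))
  ... | isExtra zero      = inj₁ (inj₂ (inj₁ (support▷extra zero)))
  ... | isLeaf (suc i)    = inj₂ (i ↑ˡ k ,
    cong [ leaf ∘ suc , extra ∘ suc ]′ (sym (Finₚ.splitAt-↑ˡ p i k)))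
  ... | isExtra (suc j)   = inj₂ (p ↑ʳ j ,
    cong [ leaf ∘ suc , extra ∘ suc ]′ (sym (Finₚ.splitAt-↑ʳ p k j)))

  L₂≡ : L[ 2 , graph ]≡ (a + suc k)
  L₂≡ =
    (allLeaves ,
      limitedPacking-⊆ graph allLeaves⊆ (limitedPacking-∪ graph leaf-packing extra-packing) ,
      ∣image∣≡ (a ↑ʳ_) (Finₚ.↑ʳ-injective a _ _)) ,
    -- The bound arrives as `2 + (p + k)`; moving one successor onto `k` turns it into `a + suc k`.
    λ S pack → subst (∣ S ∣ ≤_) (cong suc (sym (ℕₚ.+-suc p k)))
      (limitedPacking-bound-rest graph (support zero) remote near-or-remote S pack)

theorem5p5 : (a b : ℕ) → 2 ≤ a → a + 1 ≤ b → b ≤ 2 * a →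
    ∃[ T ] (IsTree T × ρ⁰[ T ]≡ a × L[ 1 , T ]≡ a × L[ 2 , T ]≡ b)
theorem5p5 (suc p) b (s≤s 1≤p) a+1≤b b≤2a =
  graph , isTree , ρ⁰≡ 1≤p , L₁≡ , subst (L[ 2 , graph ]≡_) a+suck≡b L₂≡
  where
  k : ℕ
  -- The lower bound on `b` makes this subtraction exact, so the number `suc k` of extra leaves is
  -- the difference of `b` and `a`.
  k = b ∸ (suc p + 1)

  a+suck≡b : suc p + suc k ≡ b
  a+suck≡b = trans (sym (ℕₚ.+-assoc (suc p) 1 k)) (ℕₚ.m+[n∸m]≡n a+1≤b)

  -- The upper bound on `b` says that there are at most as many extra leaves as supports, so each
  -- gets a support of its own.
  k≤p : k ≤ p
  k≤p = ℕₚ.≤-pred (ℕₚ.+-cancelˡ-≤ (suc p) (suc k) (suc p)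
    (subst₂ _≤_ (sym a+suck≡b) (cong (suc p +_) (ℕₚ.+-identityʳ (suc p))) b≤2a))

  open LeafyStar p k k≤p
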